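{- If $A$ is an infinite strongly computable finite factorization domain, then so is the polynomial ring $A[x]$. Moreover, there is a uniform computable procedure which, given an index for a function $D$ witnessing that $A$ is an SCFFD, produces an index for a function $D'$ extending $D$ that witnesses that $A[x]$ is an SCFFD.
   Context: A computable ring is a ring whose underlying set is a computable set $A \subseteq \mathbb{N}$ with addition and multiplication computable functions $A\times A \to A$. A strongly computable finite factorization domain (SCFFD) is a computable integral domain $A$ equipped with a computable function $D$ such that for every nonzero $a \in A$, $D(a)$ is a canonical index for the finite set of all divisors of $a$ in $A$. $A[x]$ is viewed as a computable ring extending $A$ via the standard coding of polynomials by finite sequences of coefficients. -}

module Defs where

open import Data.Nat using (ℕ; zero; suc; _+_; _*_; _^_; _≤_; _≟_)
open import Data.Nat.DivMod using (_/_; _%_)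
open import Data.Bool using (Bool; T)
open import Data.List using (List; []; _∷_; reverse; map)
open import Data.List.Relation.Unary.All using (All)
open import Data.Product using (Σ; _×_; _,_)
open import Data.Sum using (_⊎_)
open import Relation.Nullary using (¬_; yes; no)
open import Relation.Binary.PropositionalEquality using (_≡_; _≢_)

-- Canonical indices of finite sets:  the finite set with canonical
-- index n is { i | the i-th binary digit of n is 1 }  (n = Σ_{i∈S} 2^i).

bit : ℕ → ℕ → ℕ
bit n zero    = n % 2
bit n (suc i) = bit (n / 2) i

_∈canon_ : ℕ → ℕ → Set
i ∈canon n = bit n i ≡ 1

infix 4 _∈canon_

_⇔_ : Set → Set → Set
P ⇔ Q = (P → Q) × (Q → P)

infix 3 _⇔_

-- Computable integral domains: underlying set a decidable (Bool-valued)
-- subset A ⊆ ℕ, with total computable (Agda) operations ℕ × ℕ → ℕ that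
-- restrict to A × A → A.

record CompIntDomain : Set₁ where
  field
    isA   : ℕ → Bool
    add   : ℕ → ℕ → ℕ
    mul   : ℕ → ℕ → ℕ
    zeroA : ℕ
    oneA  : ℕ

  InA : ℕ → Set
  InA n = T (isA n)

  field
    add-closed : ∀ a b → InA a → InA b → InA (add a b)
    mul-closed : ∀ a b → InA a → InA b → InA (mul a b)
    zero-in    : InA zeroA
    one-in     : InA oneA
    add-assoc  : ∀ a b c → InA a → InA b → InA c →
                 add (add a b) c ≡ add a (add b c)
    add-comm   : ∀ a b → InA a → InA b → add a b ≡ add b a
    add-zero   : ∀ a → InA a → add a zeroA ≡ a
    add-inv    : ∀ a → InA a → Σ ℕ λ b → InA b × add a b ≡ zeroA
    mul-assoc  : ∀ a b c → InA a → InA b → InA c →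
                 mul (mul a b) c ≡ mul a (mul b c)
    mul-comm   : ∀ a b → InA a → InA b → mul a b ≡ mul b a
    mul-one    : ∀ a → InA a → mul a oneA ≡ a
    distrib    : ∀ a b c → InA a → InA b → InA c →
                 mul a (add b c) ≡ add (mul a b) (mul a c)
    one≢zero   : oneA ≢ zeroA
    no-zero-divisors : ∀ a b → InA a → InA b →
                 mul a b ≡ zeroA → a ≡ zeroA ⊎ b ≡ zeroA

module _ (R : CompIntDomain) where
  open CompIntDomain R

  Infinite : Set
  Infinite = ∀ n → Σ ℕ λ m → n ≤ m × InA m

  DividesA : ℕ → ℕ → Set
  DividesA d a = InA d × Σ ℕ λ e → InA e × mul d e ≡ a

  IsSCFFD : (ℕ → ℕ) → Set
  IsSCFFD D = ∀ a → InA a → a ≢ zeroA →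
              ∀ i → (i ∈canon D a) ⇔ DividesA i a

  -- Polynomials over A: little-endian coefficient lists, normalized
  -- (no trailing zeroA coefficient; the zero polynomial is []).

  dropZeros : List ℕ → List ℕ
  dropZeros []       = []
  dropZeros (c ∷ cs) with c ≟ zeroA
  ... | yes _ = dropZeros cs
  ... | no  _ = c ∷ cs

  normalize : List ℕ → List ℕ
  normalize p = reverse (dropZeros (reverse p))

  polyAdd : List ℕ → List ℕ → List ℕ
  polyAdd []       q        = q
  polyAdd (a ∷ p)  []       = a ∷ p
  polyAdd (a ∷ p)  (b ∷ q)  = add a b ∷ polyAdd p q

  polyMul : List ℕ → List ℕ → List ℕ
  polyMul []      q = []
  polyMul (a ∷ p) q = polyAdd (map (mul a) q) (zeroA ∷ polyMul p q)

  IsPoly : List ℕ → Set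
  IsPoly p = All InA p × normalize p ≡ p

  DividesPoly : List ℕ → List ℕ → Set
  DividesPoly g f = IsPoly g × Σ (List ℕ) λ h → IsPoly h × normalize (polyMul g h) ≡ f

pair : ℕ → ℕ → ℕ
pair x y = ((x + y) * suc (x + y)) / 2 + y

code : List ℕ → ℕ
code []       = 0
code (x ∷ xs) = suc (pair x (code xs))

module _ (R : CompIntDomain) where
  open CompIntDomain R

  ι : ℕ → ℕ
  ι a = code (normalize R (a ∷ []))

  IsPolySCFFD : (ℕ → ℕ) → Set
  IsPolySCFFD D' = ∀ f → IsPoly R f → f ≢ [] →
                   ∀ i → (i ∈canon D' (code f)) ⇔
                         (Σ (List ℕ) λ g → code g ≡ i × DividesPoly R g f)

  Extends : (ℕ → ℕ) → (ℕ → ℕ) → Set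
  Extends D D' = ∀ a → InA a → a ≢ zeroA →
                 ∀ i → (i ∈canon D' (ι a)) ⇔ (Σ ℕ λ d → d ∈canon D a × i ≡ ι d)

module Submission where

-- Let f ∈ A[x] be nonzero with n coefficients.  A divisor g of f has at
-- most n coefficients, so it is determined by its values at n distinct points
-- a₁ … aₙ, which we choose (using that A is infinite) among the non-roots of f.
-- Each value g(aᵢ) divides f(aᵢ) ≠ 0, so it lies in the finite list given by D.
-- To turn values into coefficients without leaving A we use Newton's form
--   g = d₁ + (x - a₁)(d₂ + (x - a₂)(…)),
-- whose divided differences dᵢ are either 0 or divisors of known nonzero
-- differences, again listed by D.  This gives a finite list of candidates
-- containing every divisor (and every cofactor); D′ keeps the candidates g
-- that are polynomials dividing f with a cofactor among the candidates.

open import Defs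
open import Level using (0ℓ)
open import Algebra.Bundles using (CommutativeRing)
open import Algebra.Structures using (IsCommutativeRing)
open import Algebra.Core using (Op₁; Op₂)
open import Data.Nat using (ℕ)
open import Data.List using (List; length)
open import Data.List.Membership.Propositional using (_∈_)
open import Data.Product using (Σ; _×_; _,_)
open import Data.Sum using (_⊎_)
open import Relation.Binary.Definitions using (DecidableEquality)
open import Relation.Binary.PropositionalEquality using (_≡_)

-- An integral domain with decidable equality, stated with propositional
-- equality so that polynomials over it can be compared with _≡_.
record IntegralDomain : Set₁ where
  infixl 6 _+_
  infixl 7 _*_
  infix  8 -_
  field
    Carrier           : Set
    _+_ _*_           : Op₂ Carrier
    -_                : Op₁ Carrier
    0# 1#             : Carrier
    isCommutativeRing : IsCommutativeRing _≡_ _+_ _*_ -_ 0# 1#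
    _≟_               : DecidableEquality Carrier
    zero-product      : ∀ x y → x * y ≡ 0# → x ≡ 0# ⊎ y ≡ 0#

  commutativeRing : CommutativeRing 0ℓ 0ℓ
  commutativeRing = record { isCommutativeRing = isCommutativeRing }

module Polynomials (𝔻 : IntegralDomain) where

  open IntegralDomain 𝔻
  open CommutativeRing commutativeRing
    using (+-identityˡ; +-identityʳ; +-assoc; -‿inverseˡ; -‿inverseʳ; zeroˡ; zeroʳ;
           ring; commutativeSemiring; +-group)
  open import Algebra.Properties.Ring ring using (-‿distribʳ-*; -‿+-comm)
  open import Algebra.Properties.Group +-group using (x∙y⁻¹≈ε⇒x≈y; x≈y⇒x∙y⁻¹≈ε; ε⁻¹≈ε; ⁻¹-injective)
  open import Algebra.Solver.Ring.NaturalCoefficients.Default commutativeSemiring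
    using (solve; _:+_; _:*_; _:=_; con)
  import Data.Nat as ℕ
  open import Data.Nat using (ℕ; zero; suc; _≤_; _<_; _⊔_; z≤n; s≤s)
  open import Data.Nat.Properties using (⊔-lub; ≤-trans; ≤-reflexive; ≤-pred; +-comm; +-monoʳ-≤; +-monoˡ-≤)
  open import Data.List using (List; []; _∷_; map; length)
  open import Data.List.Properties using (length-map; ∷-injectiveˡ)
  open import Data.List.Relation.Unary.All as All using (All; []; _∷_)
  open import Data.List.Relation.Unary.All.Properties using (map⁻)
  open import Data.List.Relation.Unary.AllPairs using (AllPairs; []; _∷_)
  open import Data.Product using (Σ; _×_; _,_; proj₁; proj₂)
  open import Data.Sum using (inj₁; inj₂)
  open import Relation.Nullary using (¬_; yes; no)
  open import Relation.Nullary.Negation using (contradiction)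
  open import Function using (_∘_)
  open import Relation.Binary.PropositionalEquality
  open ≡-Reasoning

  infixl 6 _⊕_ _⊖_ _-_
  infixl 7 _⊗_ _∙_

  _-_ : Carrier → Carrier → Carrier
  x - y = x + - y

  -- A polynomial is its list of coefficients, constant term first.
  Poly : Set
  Poly = List Carrier

  _⊕_ : Poly → Poly → Poly
  []      ⊕ q       = q
  (a ∷ p) ⊕ []      = a ∷ p
  (a ∷ p) ⊕ (b ∷ q) = a + b ∷ p ⊕ q

  _∙_ : Carrier → Poly → Poly
  c ∙ p = map (c *_) p

  _⊗_ : Poly → Poly → Poly
  []      ⊗ q = []
  (a ∷ p) ⊗ q = a ∙ q ⊕ (0# ∷ p ⊗ q)

  ⊝_ : Poly → Poly
  ⊝_ = map (λ c → - c)

  _⊖_ : Poly → Poly → Poly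
  p ⊖ q = p ⊕ ⊝ q

  ⟦_⟧ : Poly → Carrier → Carrier
  ⟦ []    ⟧ x = 0#
  ⟦ c ∷ p ⟧ x = c + x * ⟦ p ⟧ x

  ⟦⊕⟧ : ∀ p q x → ⟦ p ⊕ q ⟧ x ≡ ⟦ p ⟧ x + ⟦ q ⟧ x
  ⟦⊕⟧ []      q       x = sym (+-identityˡ _)
  ⟦⊕⟧ (a ∷ p) []      x = sym (+-identityʳ _)
  ⟦⊕⟧ (a ∷ p) (b ∷ q) x = begin
    a + b + x * ⟦ p ⊕ q ⟧ x            ≡⟨ cong (λ t → a + b + x * t) (⟦⊕⟧ p q x) ⟩
    a + b + x * (⟦ p ⟧ x + ⟦ q ⟧ x)    ≡⟨ solve 5 (λ a b x P Q → a :+ b :+ x :* (P :+ Q)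
                                             := a :+ x :* P :+ (b :+ x :* Q)) refl a b x (⟦ p ⟧ x) (⟦ q ⟧ x) ⟩
    a + x * ⟦ p ⟧ x + (b + x * ⟦ q ⟧ x) ∎

  ⟦∙⟧ : ∀ c q x → ⟦ c ∙ q ⟧ x ≡ c * ⟦ q ⟧ x
  ⟦∙⟧ c []      x = sym (zeroʳ c)
  ⟦∙⟧ c (b ∷ q) x = begin
    c * b + x * ⟦ c ∙ q ⟧ x   ≡⟨ cong (λ t → c * b + x * t) (⟦∙⟧ c q x) ⟩
    c * b + x * (c * ⟦ q ⟧ x) ≡⟨ solve 4 (λ c b x Q → c :* b :+ x :* (c :* Q) := c :* (b :+ x :* Q))
                                   refl c b x (⟦ q ⟧ x) ⟩
    c * (b + x * ⟦ q ⟧ x)     ∎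

  ⟦⊗⟧ : ∀ p q x → ⟦ p ⊗ q ⟧ x ≡ ⟦ p ⟧ x * ⟦ q ⟧ x
  ⟦⊗⟧ []      q x = sym (zeroˡ _)
  ⟦⊗⟧ (a ∷ p) q x = begin
    ⟦ a ∙ q ⊕ (0# ∷ p ⊗ q) ⟧ x                  ≡⟨ ⟦⊕⟧ (a ∙ q) (0# ∷ p ⊗ q) x ⟩
    ⟦ a ∙ q ⟧ x + (0# + x * ⟦ p ⊗ q ⟧ x)         ≡⟨ cong₂ (λ s t → s + (0# + x * t)) (⟦∙⟧ a q x) (⟦⊗⟧ p q x) ⟩
    a * ⟦ q ⟧ x + (0# + x * (⟦ p ⟧ x * ⟦ q ⟧ x)) ≡⟨ cong (a * ⟦ q ⟧ x +_) (+-identityˡ _) ⟩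
    a * ⟦ q ⟧ x + x * (⟦ p ⟧ x * ⟦ q ⟧ x)        ≡⟨ solve 4 (λ a x P Q → a :* Q :+ x :* (P :* Q)
                                                       := (a :+ x :* P) :* Q) refl a x (⟦ p ⟧ x) (⟦ q ⟧ x) ⟩
    (a + x * ⟦ p ⟧ x) * ⟦ q ⟧ x                  ∎

  ⟦⊝⟧ : ∀ q x → ⟦ ⊝ q ⟧ x ≡ - ⟦ q ⟧ x
  ⟦⊝⟧ []      x = sym ε⁻¹≈ε
  ⟦⊝⟧ (b ∷ q) x = begin
    - b + x * ⟦ ⊝ q ⟧ x  ≡⟨ cong (λ t → - b + x * t) (⟦⊝⟧ q x) ⟩
    - b + x * - ⟦ q ⟧ x  ≡⟨ cong (- b +_) (sym (-‿distribʳ-* x (⟦ q ⟧ x))) ⟩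
    - b + - (x * ⟦ q ⟧ x) ≡⟨ -‿+-comm b (x * ⟦ q ⟧ x) ⟩
    - (b + x * ⟦ q ⟧ x)  ∎

  ⟦⊖⟧ : ∀ p q x → ⟦ p ⊖ q ⟧ x ≡ ⟦ p ⟧ x - ⟦ q ⟧ x
  ⟦⊖⟧ p q x = trans (⟦⊕⟧ p (⊝ q) x) (cong (⟦ p ⟧ x +_) (⟦⊝⟧ q x))

  difference-zero : ∀ x y → x - y ≡ 0# → x ≡ y
  difference-zero = x∙y⁻¹≈ε⇒x≈y

  negation-zero : ∀ x → - x ≡ 0# → x ≡ 0#
  negation-zero x e = ⁻¹-injective (trans e (sym ε⁻¹≈ε))

  product-nonzero : ∀ {x y} → x ≢ 0# → y ≢ 0# → x * y ≢ 0#
  product-nonzero {x} {y} x≢0 y≢0 e with zero-product x y e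
  ... | inj₁ x≡0 = x≢0 x≡0
  ... | inj₂ y≡0 = y≢0 y≡0

  difference-cancel : ∀ {x y} z → x ≢ y → (x - y) * z ≡ 0# → z ≡ 0#
  difference-cancel {x} {y} z x≢y e with zero-product (x - y) z e
  ... | inj₁ d≡0 = contradiction (difference-zero x y d≡0) x≢y
  ... | inj₂ z≡0 = z≡0

  plus-times-zero : ∀ c a → c + a * 0# ≡ c
  plus-times-zero c a = trans (cong (c +_) (zeroʳ a)) (+-identityʳ c)

  minus-plus : ∀ x a → x - a + a ≡ x
  minus-plus x a = trans (+-assoc x (- a) a) (trans (cong (x +_) (-‿inverseˡ a)) (+-identityʳ x))

  plus-minus : ∀ r w → r + w - r ≡ w
  plus-minus r w = begin
    r + w + - r   ≡⟨ solve 3 (λ r w n → r :+ w :+ n := w :+ (r :+ n)) refl r w (- r) ⟩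
    w + (r - r)   ≡⟨ cong (w +_) (-‿inverseʳ r) ⟩
    w + 0#        ≡⟨ +-identityʳ w ⟩
    w             ∎

  _∷ₙ_ : Carrier → Poly → Poly
  c ∷ₙ [] with c ≟ 0#
  ... | yes _ = []
  ... | no  _ = c ∷ []
  c ∷ₙ (d ∷ p) = c ∷ d ∷ p

  trim : Poly → Poly
  trim []      = []
  trim (c ∷ p) = c ∷ₙ trim p

  AllZero : Poly → Set
  AllZero = All (_≡ 0#)

  data LeadingNonZero : Poly → Set where
    [_] : ∀ {c} → c ≢ 0# → LeadingNonZero (c ∷ [])
    _∷_ : ∀ c {p} → LeadingNonZero p → LeadingNonZero (c ∷ p)

  trimmed⇒LeadingNonZero : ∀ c p → trim (c ∷ p) ≡ c ∷ p → LeadingNonZero (c ∷ p)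
  trimmed⇒LeadingNonZero c p e with trim p in eq
  trimmed⇒LeadingNonZero c p e | [] with c ≟ 0#
  ... | yes _ = contradiction e λ ()
  ... | no c≢0 with e
  ...   | refl = [ c≢0 ]
  trimmed⇒LeadingNonZero c p e | d ∷ q with e
  ... | refl = c ∷ trimmed⇒LeadingNonZero d q eq

  LeadingNonZero⇒nonempty : ∀ {p} → LeadingNonZero p → p ≢ []
  LeadingNonZero⇒nonempty [ _ ]   ()
  LeadingNonZero⇒nonempty (_ ∷ _) ()

  trimmed-nonempty⇒LeadingNonZero : ∀ p → trim p ≡ p → p ≢ [] → LeadingNonZero p
  trimmed-nonempty⇒LeadingNonZero []      _ p≢[] = contradiction refl p≢[]
  trimmed-nonempty⇒LeadingNonZero (c ∷ p) t _    = trimmed⇒LeadingNonZero c p t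

  LeadingNonZero⇒trimmed : ∀ {p} → LeadingNonZero p → trim p ≡ p
  LeadingNonZero⇒trimmed {c ∷ []} [ c≢0 ] with c ≟ 0#
  ... | yes c≡0 = contradiction c≡0 c≢0
  ... | no  _   = refl
  LeadingNonZero⇒trimmed {c ∷ p} (c ∷ lp) with trim p | LeadingNonZero⇒trimmed lp
  ... | _ | refl with lp
  ...   | [ _ ]  = refl
  ...   | _ ∷ _  = refl

  trim-AllZero : ∀ {p} → AllZero p → trim p ≡ []
  trim-AllZero {[]}    []       = refl
  trim-AllZero {c ∷ p} (c≡0 ∷ z) rewrite trim-AllZero z with c ≟ 0#
  ... | yes _   = refl
  ... | no  c≢0 = contradiction c≡0 c≢0

  LeadingNonZero⇒¬AllZero : ∀ {p} → LeadingNonZero p → ¬ AllZero p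
  LeadingNonZero⇒¬AllZero [ c≢0 ]   (c≡0 ∷ _) = c≢0 c≡0
  LeadingNonZero⇒¬AllZero (_ ∷ lp) (_ ∷ z)   = LeadingNonZero⇒¬AllZero lp z

  length≥1 : ∀ {p} → LeadingNonZero p → 1 ≤ length p
  length≥1 [ _ ]  = s≤s z≤n
  length≥1 (_ ∷ _) = s≤s z≤n

  AllZero-⊖⇒trim≡ : ∀ p q → AllZero (p ⊖ q) → trim p ≡ trim q
  AllZero-⊖⇒trim≡ []      q       z = sym (trim-AllZero (All.map (negation-zero _) (map⁻ z)))
  AllZero-⊖⇒trim≡ (c ∷ p) []      z = trim-AllZero z
  AllZero-⊖⇒trim≡ (c ∷ p) (d ∷ q) (e ∷ z)
    rewrite AllZero-⊖⇒trim≡ p q z | difference-zero c d e = refl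

  ⊕-identityʳ : ∀ p → p ⊕ [] ≡ p
  ⊕-identityʳ []      = refl
  ⊕-identityʳ (a ∷ p) = refl

  length-⊕ : ∀ p q → length (p ⊕ q) ≡ length p ⊔ length q
  length-⊕ []      q       = refl
  length-⊕ (a ∷ p) []      = refl
  length-⊕ (a ∷ p) (b ∷ q) = cong suc (length-⊕ p q)

  ∙-LeadingNonZero : ∀ {c q} → c ≢ 0# → LeadingNonZero q → LeadingNonZero (c ∙ q)
  ∙-LeadingNonZero c≢0 [ b≢0 ]   = [ product-nonzero c≢0 b≢0 ]
  ∙-LeadingNonZero c≢0 (b ∷ lq) = _ ∷ ∙-LeadingNonZero c≢0 lq

  ⊕-longer : ∀ p {q} → length p < length q → LeadingNonZero q →
             LeadingNonZero (p ⊕ q) × length (p ⊕ q) ≡ length q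
  ⊕-longer []      lt lq = lq , refl
  ⊕-longer (a ∷ p) (s≤s ()) [ _ ]
  ⊕-longer (a ∷ p) (s≤s lt) (b ∷ lq) with ⊕-longer p lt lq
  ... | lpq , len = _ ∷ lpq , cong suc len

  constant-⊗ : ∀ c b q → (c ∷ []) ⊗ (b ∷ q) ≡ c ∙ (b ∷ q)
  constant-⊗ c b q = cong₂ _∷_ (+-identityʳ (c * b)) (⊕-identityʳ (c ∙ q))

  ⊗-LeadingNonZero : ∀ {p q} → LeadingNonZero p → LeadingNonZero q →
                     LeadingNonZero (p ⊗ q) × suc (length (p ⊗ q)) ≡ length p ℕ.+ length q
  ⊗-LeadingNonZero {c ∷ []} {b ∷ q} [ c≢0 ] lq =
    subst (λ r → LeadingNonZero r × suc (length r) ≡ suc (suc (length q))) (sym (constant-⊗ c b q))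
          (∙-LeadingNonZero c≢0 lq , cong (suc ∘ suc) (length-map (c *_) q))
  ⊗-LeadingNonZero {a ∷ p} {q} (a ∷ lp) lq with ⊗-LeadingNonZero lp lq
  ... | lpq , len with ⊕-longer (a ∙ q) shorter (0# ∷ lpq)
    where
    shorter : length (a ∙ q) < suc (length (p ⊗ q))
    shorter rewrite length-map (a *_) q | len = +-monoˡ-≤ (length q) (length≥1 lp)
  ... | lsum , len′ = lsum , cong suc (trans len′ len)

  factor-length : ∀ {g h} → LeadingNonZero g → LeadingNonZero h →
                  length g ≤ length (g ⊗ h) × length h ≤ length (g ⊗ h)
  factor-length {g} {h} lg lh =
      ≤-pred (≤-trans (≤-reflexive (+-comm 1 (length g)))
                      (≤-trans (+-monoʳ-≤ (length g) (length≥1 lh)) (≤-reflexive (sym len))))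
    , ≤-pred (≤-trans (+-monoˡ-≤ (length h) (length≥1 lg)) (≤-reflexive (sym len)))
    where
    len : suc (length (g ⊗ h)) ≡ length g ℕ.+ length h
    len = proj₂ (⊗-LeadingNonZero lg lh)

  ⊗-[] : ∀ p → AllZero (p ⊗ [])
  ⊗-[] []      = []
  ⊗-[] (a ∷ p) = refl ∷ ⊗-[] p

  quotient : Carrier → Poly → Poly
  quotient a []          = []
  quotient a (c ∷ [])    = []
  quotient a (c ∷ d ∷ p) = ⟦ d ∷ p ⟧ a ∷ quotient a (d ∷ p)

  division : ∀ a p x → ⟦ p ⟧ x ≡ ⟦ p ⟧ a + (x - a) * ⟦ quotient a p ⟧ x
  division a []          x = solve 3 (λ u a x → con 0 := con 0 :+ u :* con 0) refl (x - a) a x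
  division a (c ∷ [])    x = solve 4 (λ u c a x → c :+ x :* con 0 := c :+ a :* con 0 :+ u :* con 0)
                                     refl (x - a) c a x
  division a (c ∷ d ∷ p) x = begin
    c + x * ⟦ d ∷ p ⟧ x              ≡⟨ cong (λ t → c + x * t) (division a (d ∷ p) x) ⟩
    c + x * (R + u * Q)              ≡⟨ cong (λ t → c + t * (R + u * Q)) (sym (minus-plus x a)) ⟩
    c + (u + a) * (R + u * Q)        ≡⟨ solve 5 (λ c a R Q u → c :+ (u :+ a) :* (R :+ u :* Q)
                                          := c :+ a :* R :+ u :* (R :+ (u :+ a) :* Q)) refl c a R Q u ⟩
    c + a * R + u * (R + (u + a) * Q) ≡⟨ cong (λ t → c + a * R + u * (R + t * Q)) (minus-plus x a) ⟩
    c + a * R + u * (R + x * Q)      ∎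
    where
    R = ⟦ d ∷ p ⟧ a
    Q = ⟦ quotient a (d ∷ p) ⟧ x
    u = x - a

  difference-quotient : ∀ a p b → ⟦ p ⟧ b - ⟦ p ⟧ a ≡ (b - a) * ⟦ quotient a p ⟧ b
  difference-quotient a p b =
    trans (cong (_- ⟦ p ⟧ a) (division a p b)) (plus-minus (⟦ p ⟧ a) ((b - a) * ⟦ quotient a p ⟧ b))

  length-quotient : ∀ a p n → length p ≤ suc n → length (quotient a p) ≤ n
  length-quotient a []          n       _        = z≤n
  length-quotient a (c ∷ [])    n       _        = z≤n
  length-quotient a (c ∷ d ∷ p) (suc n) (s≤s le) = s≤s (length-quotient a (d ∷ p) n le)

  quotient-zero : ∀ a p → AllZero (quotient a p) → ⟦ p ⟧ a ≡ 0# → AllZero p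
  quotient-zero a []          _         _ = []
  quotient-zero a (c ∷ [])    _         e = trans (sym (plus-times-zero c a)) e ∷ []
  quotient-zero a (c ∷ d ∷ p) (R≡0 ∷ z) e =
    trans (sym (trans (cong (λ t → c + a * t) R≡0) (plus-times-zero c a))) e ∷ quotient-zero a (d ∷ p) z R≡0

  Distinct : List Carrier → Set
  Distinct = AllPairs _≢_

  root-bound : ∀ {as} → Distinct as → ∀ p → length p ≤ length as →
               All (λ a → ⟦ p ⟧ a ≡ 0#) as → AllZero p
  root-bound {[]}     []            []      _  _               = []
  root-bound {a ∷ as} (a≢as ∷ das) p       le (pa≡0 ∷ roots) =
    quotient-zero a p (root-bound das (quotient a p) (length-quotient a p _ le)
                                  (All.zipWith quotient-root (a≢as , roots))) pa≡0
    where
    quotient-root : ∀ {b} → a ≢ b × ⟦ p ⟧ b ≡ 0# → ⟦ quotient a p ⟧ b ≡ 0#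
    quotient-root {b} (a≢b , pb≡0) = difference-cancel _ (a≢b ∘ sym) (begin
      (b - a) * ⟦ quotient a p ⟧ b  ≡⟨ sym (difference-quotient a p b) ⟩
      ⟦ p ⟧ b - ⟦ p ⟧ a             ≡⟨ cong₂ _-_ pb≡0 pa≡0 ⟩
      0# - 0#                       ≡⟨ -‿inverseʳ 0# ⟩
      0#                            ∎)

  interpolation-unique : ∀ {as} → Distinct as → ∀ p q → length p ≤ length as → length q ≤ length as →
                         All (λ a → ⟦ p ⟧ a ≡ ⟦ q ⟧ a) as → trim p ≡ trim q
  interpolation-unique {as} das p q lp lq agree =
    AllZero-⊖⇒trim≡ p q (root-bound das (p ⊖ q) length-⊖ (All.map (λ e → trans (⟦⊖⟧ p q _) (x≈y⇒x∙y⁻¹≈ε e)) agree))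
    where
    length-⊖ : length (p ⊖ q) ≤ length as
    length-⊖ rewrite length-⊕ p (⊝ q) | length-map (λ c → - c) q = ⊔-lub lp lq

  factorisation : ∀ {f} g h → LeadingNonZero f → trim g ≡ g → trim h ≡ h → trim (g ⊗ h) ≡ f →
                  LeadingNonZero g × LeadingNonZero h × g ⊗ h ≡ f
  factorisation {f} g h lf tg th e = lg , lh , trans (sym (LeadingNonZero⇒trimmed (proj₁ (⊗-LeadingNonZero lg lh)))) e
    where
    lg : LeadingNonZero g
    lg = trimmed-nonempty⇒LeadingNonZero g tg λ g≡[] →
           LeadingNonZero⇒nonempty lf (trans (sym e) (cong (λ t → trim (t ⊗ h)) g≡[]))
    lh : LeadingNonZero h
    lh = trimmed-nonempty⇒LeadingNonZero h th λ h≡[] →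
           LeadingNonZero⇒nonempty lf (trans (sym e) (trans (cong (λ t → trim (g ⊗ t)) h≡[]) (trim-AllZero (⊗-[] g))))

  constant-factors : ∀ {g h c} → LeadingNonZero g → LeadingNonZero h → g ⊗ h ≡ c ∷ [] →
                     Σ Carrier λ d → Σ Carrier λ e → g ≡ d ∷ [] × h ≡ e ∷ [] × d * e ≡ c
  constant-factors {g} {h} lg lh gh≡c with factor-length lg lh
  ... | g≤ , h≤ with constant lg (subst (λ t → length g ≤ length t) gh≡c g≤)
                   | constant lh (subst (λ t → length h ≤ length t) gh≡c h≤)
    where
    constant : ∀ {p} → LeadingNonZero p → length p ≤ 1 → Σ Carrier λ d → p ≡ d ∷ []
    constant ([_] {d} _)   _           = d , refl
    constant (_ ∷ [ _ ])   (s≤s ())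
    constant (_ ∷ (_ ∷ _)) (s≤s ())
  ... | d , refl | e , refl = d , e , refl , refl , trans (sym (+-identityʳ (d * e))) (∷-injectiveˡ gh≡c)

module Interpolation (𝔻 : IntegralDomain) where

  open IntegralDomain 𝔻
  open Polynomials 𝔻
  open CommutativeRing commutativeRing using (+-identityˡ; *-comm; commutativeSemiring)
  open import Algebra.Solver.Ring.NaturalCoefficients.Default commutativeSemiring
    using (solve; _:+_; _:*_; _:=_)
  open import Data.Nat using (_≤_; z≤n; s≤s)
  open import Data.Nat.Properties using (⊔-lub; ≤-trans; n≤1+n)
  open import Data.List using (List; []; _∷_; map; length; concatMap)
  open import Data.List.Properties using (length-map)
  open import Data.List.Membership.Propositional using (_∈_)
  open import Data.List.Membership.Propositional.Properties using (∈-map⁺; ∈-concat⁺′)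
  open import Data.List.Relation.Unary.All as All using (All; []; _∷_)
  open import Data.List.Relation.Unary.Any using (here)
  open import Data.List.Relation.Unary.AllPairs using ([]; _∷_)
  open import Data.List.Relation.Binary.Pointwise using (Pointwise; []; _∷_)
  open import Data.Product using (Σ; _×_; _,_; proj₁; proj₂)
  open import Relation.Nullary using (yes; no)
  open import Relation.Binary.PropositionalEquality
  open ≡-Reasoning

  times-linear : Carrier → Poly → Poly
  times-linear a q = (- a) ∙ q ⊕ (0# ∷ q)

  ⟦times-linear⟧ : ∀ a q x → ⟦ times-linear a q ⟧ x ≡ (x - a) * ⟦ q ⟧ x
  ⟦times-linear⟧ a q x = begin
    ⟦ (- a) ∙ q ⊕ (0# ∷ q) ⟧ x       ≡⟨ ⟦⊕⟧ ((- a) ∙ q) (0# ∷ q) x ⟩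
    ⟦ (- a) ∙ q ⟧ x + (0# + x * Q)   ≡⟨ cong₂ _+_ (⟦∙⟧ (- a) q x) (+-identityˡ (x * Q)) ⟩
    - a * Q + x * Q                  ≡⟨ solve 3 (λ n x Q → n :* Q :+ x :* Q := (x :+ n) :* Q) refl (- a) x Q ⟩
    (x - a) * Q                      ∎
    where Q = ⟦ q ⟧ x

  newton : List Carrier → List Carrier → Poly
  newton (a ∷ as) (d ∷ ds) = (d ∷ []) ⊕ times-linear a (newton as ds)
  newton _        _        = []

  ⟦newton⟧ : ∀ a as d ds x → ⟦ newton (a ∷ as) (d ∷ ds) ⟧ x ≡ d + (x - a) * ⟦ newton as ds ⟧ x
  ⟦newton⟧ a as d ds x = begin
    ⟦ (d ∷ []) ⊕ times-linear a N ⟧ x        ≡⟨ ⟦⊕⟧ (d ∷ []) (times-linear a N) x ⟩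
    d + x * 0# + ⟦ times-linear a N ⟧ x      ≡⟨ cong₂ _+_ (plus-times-zero d x) (⟦times-linear⟧ a N x) ⟩
    d + (x - a) * ⟦ N ⟧ x                    ∎
    where N = newton as ds

  length-newton : ∀ as ds → length (newton as ds) ≤ length as
  length-newton []       ds       = z≤n
  length-newton (a ∷ as) []       = z≤n
  length-newton (a ∷ as) (d ∷ ds)
    rewrite length-⊕ (d ∷ []) (times-linear a (newton as ds))
          | length-⊕ ((- a) ∙ newton as ds) (0# ∷ newton as ds)
          | length-map (- a *_) (newton as ds)
          = ⊔-lub (s≤s z≤n) (⊔-lub (≤-trans (length-newton as ds) (n≤1+n _)) (s≤s (length-newton as ds)))

  -- Enumeration of candidate divisors from a finite supply of divisors of the
  -- elements of the domain: a divisor g of f is determined by its values at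
  -- deg f + 1 distinct non-roots a of f, and each value g(a) divides f(a).
  -- Newton's divided differences turn value lists into coefficient lists while
  -- staying inside the domain, since each divided difference divides a known
  -- nonzero element (or is zero).
  module Candidates (divisors : Carrier → List Carrier) where

    -- Possible values of the divided difference (v - d) / (b - a).
    quotientCandidates : Carrier → Carrier → List Carrier
    quotientCandidates d v with (v - d) ≟ 0#
    ... | yes _ = 0# ∷ []
    ... | no  _ = divisors (v - d)

    -- Possible Newton coefficients at nodes as, given possible values Vs at those nodes.
    coefficientCandidates : List Carrier → List (List Carrier) → List (List Carrier)
    coefficientCandidates []       _        = [] ∷ []
    coefficientCandidates (a ∷ as) []       = []
    coefficientCandidates (a ∷ as) (V ∷ Vs) =
      concatMap (λ d → map (d ∷_) (coefficientCandidates as (map (concatMap (quotientCandidates d)) Vs))) V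

    candidates : Poly → List Carrier → List Poly
    candidates f as =
      map (λ ds → trim (newton as ds)) (coefficientCandidates as (map (λ a → divisors (⟦ f ⟧ a)) as))

    module Complete (divisors-complete : ∀ {n} e m → n ≢ 0# → e * m ≡ n → e ∈ divisors n) where

      quotient-values : ∀ a p {as Vs} → All (a ≢_) as → Pointwise (λ b V → ⟦ p ⟧ b ∈ V) as Vs →
                        Pointwise (λ b V → ⟦ quotient a p ⟧ b ∈ V) as
                                  (map (concatMap (quotientCandidates (⟦ p ⟧ a))) Vs)
      quotient-values a p []          []            = []
      quotient-values a p (a≢b ∷ a≢bs) (pb∈V ∷ vals) =
        ∈-concat⁺′ (quotient∈ a≢b) (∈-map⁺ (quotientCandidates (⟦ p ⟧ a)) pb∈V) ∷ quotient-values a p a≢bs vals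
        where
        quotient∈ : ∀ {b} → a ≢ b → ⟦ quotient a p ⟧ b ∈ quotientCandidates (⟦ p ⟧ a) (⟦ p ⟧ b)
        quotient∈ {b} a≢b with (⟦ p ⟧ b - ⟦ p ⟧ a) ≟ 0#
        ... | yes zero    = here (difference-cancel _ (λ b≡a → a≢b (sym b≡a))
                                   (trans (sym (difference-quotient a p b)) zero))
        ... | no  nonzero = divisors-complete _ (b - a) nonzero
                              (trans (*-comm _ (b - a)) (sym (difference-quotient a p b)))

      newton-complete : ∀ {as} → Distinct as → ∀ {Vs} p → length p ≤ length as →
                        Pointwise (λ a V → ⟦ p ⟧ a ∈ V) as Vs →
                        Σ (List Carrier) λ ds → ds ∈ coefficientCandidates as Vs ×
                                                (∀ x → ⟦ newton as ds ⟧ x ≡ ⟦ p ⟧ x)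
      newton-complete [] [] _ [] = [] , here refl , λ _ → refl
      newton-complete {a ∷ as} (a≢as ∷ das) {V ∷ Vs} p le (pa∈V ∷ vals)
        with newton-complete das (quotient a p) (length-quotient a p _ le) (quotient-values a p a≢as vals)
      ... | ds , ds∈ , same =
          ⟦ p ⟧ a ∷ ds
        , ∈-concat⁺′ (∈-map⁺ (⟦ p ⟧ a ∷_) ds∈) (∈-map⁺ _ pa∈V)
        , λ x → trans (⟦newton⟧ a as (⟦ p ⟧ a) ds x)
                      (trans (cong (λ t → ⟦ p ⟧ a + (x - a) * t) (same x)) (sym (division a p x)))

      divisor∈candidates : ∀ f g {as} → Distinct as → All (λ a → ⟦ f ⟧ a ≢ 0#) as →
                           trim g ≡ g → length g ≤ length as →
                           (∀ x → Σ Carrier λ m → ⟦ g ⟧ x * m ≡ ⟦ f ⟧ x) → g ∈ candidates f as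
      divisor∈candidates f g {as} das nonroots trimmed le divides
        with newton-complete das g le (values as nonroots)
        where
        values : ∀ bs → All (λ a → ⟦ f ⟧ a ≢ 0#) bs →
                 Pointwise (λ a V → ⟦ g ⟧ a ∈ V) bs (map (λ a → divisors (⟦ f ⟧ a)) bs)
        values []       []            = []
        values (b ∷ bs) (fb≢0 ∷ nrs) =
          divisors-complete _ (proj₁ (divides b)) fb≢0 (proj₂ (divides b)) ∷ values bs nrs
      ... | ds , ds∈ , same = subst (_∈ candidates f as) g≡newton (∈-map⁺ _ ds∈)
        where
        g≡newton : trim (newton as ds) ≡ g
        g≡newton = trans (interpolation-unique das (newton as ds) g (length-newton as ds) le
                                               (All.tabulate λ {b} _ → same b))
                         trimmed

-- Along an injective sequence s of elements, a nonzero polynomial f has, in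
-- every window of length f consecutive terms, a non-root (root bound).  Taking
-- the first non-root of successive windows yields length f distinct non-roots.
module NonRoots (𝔻 : IntegralDomain) (s : ℕ → IntegralDomain.Carrier 𝔻)
                (s-injective : ∀ {i j} → s i ≡ s j → i ≡ j) where

  open IntegralDomain 𝔻 using (Carrier; _≟_; 0#)
  open Polynomials 𝔻
  open import Data.Nat using (zero; suc; _+_; _≤_; _<_)
  open import Data.Nat.Properties using (≤-trans; ≤-reflexive; n≤1+n; m≤m+n; <⇒≢; +-monoʳ-<)
  open import Data.List using (List; []; _∷_; map; length; applyUpTo)
  open import Data.List.Properties using (length-map; length-applyUpTo)
  open import Data.List.Membership.Propositional using (_∈_)
  open import Data.List.Membership.Propositional.Properties using (∈-applyUpTo⁻)
  open import Data.List.Relation.Unary.Any using (here; there)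
  open import Data.List.Relation.Unary.All using (All; []; _∷_)
  import Data.List.Relation.Unary.All as All
  import Data.List.Relation.Unary.All.Properties as All
  open import Data.List.Relation.Unary.AllPairs using (AllPairs; []; _∷_)
  import Data.List.Relation.Unary.AllPairs as AllPairs
  import Data.List.Relation.Unary.AllPairs.Properties as AllPairs
  import Data.Product as Product
  open import Data.Product using (_×_; _,_; proj₁; proj₂)
  open import Function using (_∘_)
  open import Relation.Nullary using (¬_; yes; no)
  open import Relation.Nullary.Negation using (contradiction)
  open import Relation.Binary.PropositionalEquality using (_≢_; refl; sym; trans; cong)

  module _ (f : Poly) where

    window : ℕ → List ℕ
    window m = applyUpTo (m +_) (length f)

    firstNonRoot : List ℕ → ℕ → ℕ
    firstNonRoot []       d = d
    firstNonRoot (k ∷ ks) d with ⟦ f ⟧ (s k) ≟ 0#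
    ... | yes _ = firstNonRoot ks d
    ... | no  _ = k

    firstNonRoot-spec : ∀ ks d → ¬ All (λ k → ⟦ f ⟧ (s k) ≡ 0#) ks →
                        firstNonRoot ks d ∈ ks × ⟦ f ⟧ (s (firstNonRoot ks d)) ≢ 0#
    firstNonRoot-spec []       d none = contradiction [] none
    firstNonRoot-spec (k ∷ ks) d none with ⟦ f ⟧ (s k) ≟ 0#
    ... | yes fk≡0 = Product.map₁ there (firstNonRoot-spec ks d (none ∘ (fk≡0 ∷_)))
    ... | no  fk≢0 = here refl , fk≢0

    nextNonRoot : ℕ → ℕ
    nextNonRoot m = firstNonRoot (window m) m

    nonRootIndices : ℕ → ℕ → List ℕ
    nonRootIndices zero    m = []
    nonRootIndices (suc c) m = nextNonRoot m ∷ nonRootIndices c (suc (nextNonRoot m))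

    nonRoots : List Carrier
    nonRoots = map s (nonRootIndices (length f) 0)

    length-nonRoots : length nonRoots ≡ length f
    length-nonRoots = trans (length-map s (nonRootIndices (length f) 0)) (length-indices (length f) 0)
      where
      length-indices : ∀ c m → length (nonRootIndices c m) ≡ c
      length-indices zero    m = refl
      length-indices (suc c) m = cong suc (length-indices c (suc (nextNonRoot m)))

    module _ (lf : LeadingNonZero f) where

      window-has-nonRoot : ∀ m → ¬ All (λ k → ⟦ f ⟧ (s k) ≡ 0#) (window m)
      window-has-nonRoot m roots =
        LeadingNonZero⇒¬AllZero lf (root-bound distinct f (≤-reflexive (sym length-window)) (All.map⁺ roots))
        where
        distinct : Distinct (map s (window m))
        distinct = AllPairs.map⁺ (AllPairs.applyUpTo⁺₁ (m +_) (length f)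
                     (λ i<j _ e → <⇒≢ (+-monoʳ-< m i<j) (s-injective e)))
        length-window : length (map s (window m)) ≡ length f
        length-window = trans (length-map s (window m)) (length-applyUpTo (m +_) (length f))

      nextNonRoot-spec : ∀ m → m ≤ nextNonRoot m × ⟦ f ⟧ (s (nextNonRoot m)) ≢ 0#
      nextNonRoot-spec m with firstNonRoot-spec (window m) m (window-has-nonRoot m)
      ... | k∈window , fk≢0 with ∈-applyUpTo⁻ (m +_) k∈window
      ...   | i , _ , k≡m+i = ≤-trans (m≤m+n m i) (≤-reflexive (sym k≡m+i)) , fk≢0

      indices-above : ∀ c m → All (m ≤_) (nonRootIndices c m)
      indices-above zero    m = []
      indices-above (suc c) m = proj₁ (nextNonRoot-spec m)
        ∷ All.map (≤-trans (≤-trans (proj₁ (nextNonRoot-spec m)) (n≤1+n _))) (indices-above c (suc (nextNonRoot m)))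

      indices-increasing : ∀ c m → AllPairs _<_ (nonRootIndices c m)
      indices-increasing zero    m = []
      indices-increasing (suc c) m =
        indices-above c (suc (nextNonRoot m)) ∷ indices-increasing c (suc (nextNonRoot m))

      indices-nonRoots : ∀ c m → All (λ k → ⟦ f ⟧ (s k) ≢ 0#) (nonRootIndices c m)
      indices-nonRoots zero    m = []
      indices-nonRoots (suc c) m = proj₂ (nextNonRoot-spec m) ∷ indices-nonRoots c (suc (nextNonRoot m))

      nonRoots-distinct : Distinct nonRoots
      nonRoots-distinct = AllPairs.map⁺ (AllPairs.map (λ i<j e → <⇒≢ i<j (s-injective e))
                                                      (indices-increasing (length f) 0))

      nonRoots-nonRoots : All (λ a → ⟦ f ⟧ a ≢ 0#) nonRoots
      nonRoots-nonRoots = All.map⁺ (indices-nonRoots (length f) 0)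

module DivisorCandidates (𝔻 : IntegralDomain) (divisors : IntegralDomain.Carrier 𝔻 → List (IntegralDomain.Carrier 𝔻))
                         (s : ℕ → IntegralDomain.Carrier 𝔻) (s-injective : ∀ {i j} → s i ≡ s j → i ≡ j) where

  open IntegralDomain 𝔻
  open Polynomials 𝔻
  open Interpolation 𝔻
  open Candidates divisors
  open NonRoots 𝔻 s s-injective
  open CommutativeRing commutativeRing using (*-comm)
  open import Data.Nat using (_≤_)
  open import Data.Product using (Σ; _×_; _,_; proj₁; proj₂)
  open import Relation.Binary.PropositionalEquality using (_≢_; sym; trans; cong; subst)

  divisorCandidates : Poly → List Poly
  divisorCandidates f = candidates f (nonRoots f)

  module _ (divisors-complete : ∀ {n} e m → n ≢ 0# → e * m ≡ n → e ∈ divisors n) where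

    open Complete divisors-complete

    factors∈divisorCandidates : ∀ {f g h} → LeadingNonZero f → LeadingNonZero g → LeadingNonZero h →
                                g ⊗ h ≡ f → g ∈ divisorCandidates f × h ∈ divisorCandidates f
    factors∈divisorCandidates {f} {g} {h} lf lg lh gh≡f =
        candidate g lg (proj₁ (factor-length lg lh)) (λ x → ⟦ h ⟧ x , product x)
      , candidate h lh (proj₂ (factor-length lg lh)) (λ x → ⟦ g ⟧ x , trans (*-comm _ _) (product x))
      where
      product : ∀ x → ⟦ g ⟧ x * ⟦ h ⟧ x ≡ ⟦ f ⟧ x
      product x = trans (sym (⟦⊗⟧ g h x)) (cong (λ t → ⟦ t ⟧ x) gh≡f)
      candidate : ∀ p → LeadingNonZero p → length p ≤ length (g ⊗ h) →
                  (∀ x → Σ Carrier λ m → ⟦ p ⟧ x * m ≡ ⟦ f ⟧ x) → p ∈ divisorCandidates f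
      candidate p lp le =
        divisor∈candidates f p (nonRoots-distinct f lf) (nonRoots-nonRoots f lf) (LeadingNonZero⇒trimmed lp)
          (subst (length p ≤_) (trans (cong length gh≡f) (sym (length-nonRoots f))) le)

module CanonicalIndex where

  open import Data.Bool using (Bool; true; false)
  open import Data.Nat using (ℕ; zero; suc; _+_; _*_; _≤_; _<_; _≟_; z≤n; s≤s)
  open import Data.Nat.Properties using (m≤m+n; m≤n+m; ≤-trans)
  open import Data.Nat.DivMod using (_/_; [m+kn]%n≡m%n; +-distrib-/-∣ʳ; m*n/n≡m; m/n<m)
  open import Data.Nat.Divisibility using (divides-refl)
  open import Data.Nat.ListAction using (sum)
  open import Data.List using (List; _∷_; filter; upTo)
  open import Data.List.Membership.Propositional using (_∈_)
  open import Data.List.Membership.Propositional.Properties using (∈-filter⁺; ∈-upTo⁺)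
  open import Data.List.Membership.DecPropositional _≟_ using (_∈?_)
  open import Data.List.Relation.Unary.Any using (here; there)
  open import Function using (_∘_)
  open import Relation.Nullary using (yes; no; does)
  open import Relation.Nullary.Negation using (contradiction)
  open import Relation.Binary.PropositionalEquality

  bitValue : Bool → ℕ
  bitValue true  = 1
  bitValue false = 0

  fromDigits : (ℕ → Bool) → ℕ → ℕ
  fromDigits d zero    = 0
  fromDigits d (suc c) = bitValue (d 0) + fromDigits (d ∘ suc) c * 2

  bit-0 : ∀ i → bit 0 i ≡ 0
  bit-0 zero    = refl
  bit-0 (suc i) = bit-0 i

  lowest-bit : ∀ b k → bit (bitValue b + k * 2) 0 ≡ bitValue b
  lowest-bit true  k = [m+kn]%n≡m%n 1 k 2
  lowest-bit false k = [m+kn]%n≡m%n 0 k 2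

  higher-bit : ∀ b k i → bit (bitValue b + k * 2) (suc i) ≡ bit k i
  higher-bit b k i = cong (λ n → bit n i) half
    where
    half : (bitValue b + k * 2) / 2 ≡ k
    half = trans (+-distrib-/-∣ʳ (bitValue b) (divides-refl k)) (cong₂ _+_ (low b) (m*n/n≡m k 2))
      where
      low : ∀ b → bitValue b / 2 ≡ 0
      low true  = refl
      low false = refl

  bit-fromDigits : ∀ d c i → i < c → bit (fromDigits d c) i ≡ bitValue (d i)
  bit-fromDigits d (suc c) zero    _        = lowest-bit (d 0) (fromDigits (d ∘ suc) c)
  bit-fromDigits d (suc c) (suc i) (s≤s lt) =
    trans (higher-bit (d 0) (fromDigits (d ∘ suc) c) i) (bit-fromDigits (d ∘ suc) c i lt)

  bit-fromDigits⁻ : ∀ d c i → bit (fromDigits d c) i ≡ 1 → d i ≡ true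
  bit-fromDigits⁻ d zero    i       e = contradiction (trans (sym (bit-0 i)) e) λ ()
  bit-fromDigits⁻ d (suc c) zero    e with d 0 | trans (sym (lowest-bit (d 0) (fromDigits (d ∘ suc) c))) e
  ... | true  | _  = refl
  ... | false | ()
  bit-fromDigits⁻ d (suc c) (suc i) e =
    bit-fromDigits⁻ (d ∘ suc) c i (trans (sym (higher-bit (d 0) (fromDigits (d ∘ suc) c) i)) e)

  ∈⇒≤sum : ∀ {i} L → i ∈ L → i ≤ sum L
  ∈⇒≤sum (x ∷ L) (here refl) = m≤m+n x (sum L)
  ∈⇒≤sum (x ∷ L) (there i∈L) = ≤-trans (∈⇒≤sum L i∈L) (m≤n+m (sum L) x)

  canonIndex : List ℕ → ℕ
  canonIndex L = fromDigits (λ j → does (j ∈? L)) (suc (sum L))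

  canonIndex⁺ : ∀ L i → i ∈ L → i ∈canon canonIndex L
  canonIndex⁺ L i i∈L =
    trans (bit-fromDigits (λ j → does (j ∈? L)) (suc (sum L)) i (s≤s (∈⇒≤sum L i∈L))) (cong bitValue member)
    where
    member : does (i ∈? L) ≡ true
    member with i ∈? L
    ... | yes _    = refl
    ... | no  i∉L = contradiction i∈L i∉L

  canonIndex⁻ : ∀ L i → i ∈canon canonIndex L → i ∈ L
  canonIndex⁻ L i e with i ∈? L | bit-fromDigits⁻ (λ j → does (j ∈? L)) (suc (sum L)) i e
  ... | yes i∈L | _ = i∈L
  ... | no  _   | ()

  member<index : ∀ n i → i ∈canon n → i < n
  member<index zero    i       e = contradiction (trans (sym (bit-0 i)) e) λ ()
  member<index (suc n) zero    e = s≤s z≤n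
  member<index (suc n) (suc i) e = ≤-trans (s≤s (member<index (suc n / 2) i e)) (m/n<m (suc n) 2 (s≤s (s≤s z≤n)))

  members : ℕ → List ℕ
  members n = filter (λ i → bit n i ≟ 1) (upTo n)

  members⁺ : ∀ n i → i ∈canon n → i ∈ members n
  members⁺ n i e = ∈-filter⁺ (λ i → bit n i ≟ 1) (∈-upTo⁺ (member<index n i e)) e

module ListCoding where

  open import Data.Nat using (ℕ; zero; suc; _+_; _*_; _≤_; _<_; _≟_; z≤n; s≤s)
  open import Data.Nat.Properties
  open import Data.Nat.DivMod using (_/_; +-distrib-/-∣ʳ; m*n/n≡m)
  open import Data.Nat.Divisibility using (divides-refl)
  open import Data.Nat.Solver using (module +-*-Solver)
  open import Data.List using (List; []; _∷_; map; concatMap; length; upTo)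
  open import Data.List.Membership.Propositional using (_∈_)
  open import Data.List.Membership.Propositional.Properties using (∈-map⁺; ∈-concat⁺′; ∈-upTo⁺)
  open import Data.List.Relation.Unary.Any using (here; there)
  open import Data.List.Relation.Unary.All as All using (All; []; _∷_)
  open import Data.Product using (_×_; _,_)
  open import Relation.Nullary using (yes; no)
  open import Relation.Nullary.Negation using (contradiction)
  open import Relation.Binary.Definitions using (tri<; tri≈; tri>)
  open import Relation.Binary.PropositionalEquality
  open +-*-Solver using (solve; _:+_; _:*_; _:=_; con)

  triangle : ℕ → ℕ
  triangle s = (s * suc s) / 2

  triangle-suc : ∀ s → triangle (suc s) ≡ triangle s + suc s
  triangle-suc s = trans (cong (_/ 2) expand)
    (trans (+-distrib-/-∣ʳ (s * suc s) (divides-refl (suc s))) (cong (triangle s +_) (m*n/n≡m (suc s) 2)))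
    where
    expand : suc s * suc (suc s) ≡ s * suc s + suc s * 2
    expand = solve 1 (λ s → (con 1 :+ s) :* (con 2 :+ s) := s :* (con 1 :+ s) :+ (con 1 :+ s) :* con 2) refl s

  triangle-gap : ∀ s k → triangle s + s < triangle (suc s + k)
  triangle-gap s zero    rewrite +-identityʳ s | triangle-suc s = +-monoʳ-< (triangle s) (n<1+n s)
  triangle-gap s (suc k) rewrite +-suc s k | triangle-suc (suc s + k) = <-≤-trans (triangle-gap s k) (m≤m+n _ _)

  triangle-≥ : ∀ s → s ≤ triangle s
  triangle-≥ zero    = z≤n
  triangle-≥ (suc s) rewrite triangle-suc s = m≤n+m (suc s) (triangle s)

  pair-< : ∀ x y x′ y′ → x + y < x′ + y′ → pair x y < pair x′ y′
  pair-< x y x′ y′ lt with m≤n⇒∃[o]m+o≡n lt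
  ... | k , diagonal = begin-strict
      triangle (x + y) + y          ≤⟨ +-monoʳ-≤ (triangle (x + y)) (m≤n+m y x) ⟩
      triangle (x + y) + (x + y)    <⟨ triangle-gap (x + y) k ⟩
      triangle (suc (x + y) + k)    ≡⟨ cong triangle diagonal ⟩
      triangle (x′ + y′)            ≤⟨ m≤m+n _ y′ ⟩
      triangle (x′ + y′) + y′       ∎
    where open ≤-Reasoning

  pair-injective : ∀ x y x′ y′ → pair x y ≡ pair x′ y′ → x ≡ x′ × y ≡ y′
  pair-injective x y x′ y′ e with <-cmp (x + y) (x′ + y′)
  ... | tri< lt _ _ = contradiction e (<⇒≢ (pair-< x y x′ y′ lt))
  ... | tri> _ _ gt = contradiction (sym e) (<⇒≢ (pair-< x′ y′ x y gt))
  ... | tri≈ _ same _ = x≡x′ , y≡y′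
    where
    y≡y′ : y ≡ y′
    y≡y′ = +-cancelˡ-≡ (triangle (x + y)) y y′ (trans e (cong (λ s → triangle s + y′) (sym same)))
    x≡x′ : x ≡ x′
    x≡x′ = +-cancelʳ-≡ y x x′ (trans same (cong (x′ +_) (sym y≡y′)))

  code-injective : ∀ l l′ → code l ≡ code l′ → l ≡ l′
  code-injective []      []        e = refl
  code-injective (x ∷ l) (x′ ∷ l′) e with pair-injective x (code l) x′ (code l′) (suc-injective e)
  ... | refl , codes≡ = cong (x ∷_) (code-injective l l′ codes≡)

  length≤code : ∀ l → length l ≤ code l
  length≤code []      = z≤n
  length≤code (x ∷ l) = s≤s (≤-trans (length≤code l) (m≤n+m (code l) _))

  entries≤code : ∀ l → All (_≤ code l) l
  entries≤code []      = []
  entries≤code (x ∷ l) =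
    ≤-trans x≤pair (n≤1+n _) ∷ All.map (λ le → ≤-trans le (≤-trans (m≤n+m (code l) _) (n≤1+n _))) (entries≤code l)
    where
    x≤pair : x ≤ pair x (code l)
    x≤pair = ≤-trans (m≤m+n x (code l)) (≤-trans (triangle-≥ (x + code l)) (m≤m+n _ (code l)))

  boundedLists : ℕ → ℕ → List (List ℕ)
  boundedLists zero    b = [] ∷ []
  boundedLists (suc k) b = [] ∷ concatMap (λ x → map (x ∷_) (boundedLists k b)) (upTo (suc b))

  boundedLists⁺ : ∀ k b l → length l ≤ k → All (_≤ b) l → l ∈ boundedLists k b
  boundedLists⁺ zero    b []      _        _          = here refl
  boundedLists⁺ (suc k) b []      _        _          = here refl
  boundedLists⁺ (suc k) b (x ∷ l) (s≤s le) (x≤b ∷ l≤b) =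
    there (∈-concat⁺′ (∈-map⁺ (x ∷_) (boundedLists⁺ k b l le l≤b)) (∈-map⁺ _ (∈-upTo⁺ (s≤s x≤b))))

  firstWithCode : ℕ → List (List ℕ) → List ℕ
  firstWithCode m []      = []
  firstWithCode m (l ∷ L) with code l ≟ m
  ... | yes _ = l
  ... | no  _ = firstWithCode m L

  firstWithCode-code : ∀ m L l → l ∈ L → code l ≡ m → code (firstWithCode m L) ≡ m
  firstWithCode-code m (l′ ∷ L) l l∈ e with code l′ ≟ m
  ... | yes e′ = e′
  ... | no  ne with l∈
  ...   | here refl = contradiction e ne
  ...   | there l∈L = firstWithCode-code m L l l∈L e

  decode : ℕ → List ℕ
  decode m = firstWithCode m (boundedLists m m)

  decode-code : ∀ l → decode (code l) ≡ l
  decode-code l = code-injective _ _ (firstWithCode-code (code l) (boundedLists (code l) (code l)) l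
    (boundedLists⁺ (code l) (code l) l (length≤code l) (entries≤code l)) refl)

module Coefficients (R : CompIntDomain) where

  open CompIntDomain R
  open import Data.Bool.Properties using (T?; T-irrelevant)
  open import Data.Nat using (ℕ; zero; suc; _<_; s≤s)
  import Data.Nat as ℕ
  open import Data.Nat.Properties using (<-trans; <-cmp; <⇒≢; m≤n⇒m<n∨m≡n)
  open import Data.List using (List; []; _∷_; map; reverse; _∷ʳ_; _++_)
  open import Data.List.Properties using (unfold-reverse; reverse-++; map-injective)
  open import Data.List.Relation.Unary.All using (All; []; _∷_)
  open import Data.Product using (Σ; _,_; proj₁; proj₂)
  open import Data.Sum using (inj₁; inj₂)
  open import Relation.Binary.Definitions using (tri<; tri≈; tri>)
  open import Relation.Nullary using (yes; no)
  open import Relation.Nullary.Decidable using (map′)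
  open import Relation.Nullary.Negation using (contradiction)
  open import Function using (_∘_)
  open import Relation.Binary.PropositionalEquality

  Element : Set
  Element = Σ ℕ InA

  element-≡ : ∀ {x y : Element} → proj₁ x ≡ proj₁ y → x ≡ y
  element-≡ {a , p} {.a , q} refl = cong (a ,_) (T-irrelevant p q)

  private
    infixl 6 _⊞_
    infixl 7 _⊠_

    _⊞_ _⊠_ : Element → Element → Element
    (a , p) ⊞ (b , q) = add a b , add-closed a b p q
    (a , p) ⊠ (b , q) = mul a b , mul-closed a b p q

    ⊟ : Element → Element
    ⊟ (a , p) = proj₁ (add-inv a p) , proj₁ (proj₂ (add-inv a p))

    𝟘 𝟙 : Element
    𝟘 = zeroA , zero-in
    𝟙 = oneA , one-in

    ⊞-comm : ∀ x y → x ⊞ y ≡ y ⊞ x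
    ⊞-comm (a , p) (b , q) = element-≡ (add-comm a b p q)

    ⊞-identityʳ : ∀ x → x ⊞ 𝟘 ≡ x
    ⊞-identityʳ (a , p) = element-≡ (add-zero a p)

    ⊟-inverseʳ : ∀ x → x ⊞ ⊟ x ≡ 𝟘
    ⊟-inverseʳ (a , p) = element-≡ (proj₂ (proj₂ (add-inv a p)))

    ⊠-comm : ∀ x y → x ⊠ y ≡ y ⊠ x
    ⊠-comm (a , p) (b , q) = element-≡ (mul-comm a b p q)

    ⊠-identityʳ : ∀ x → x ⊠ 𝟙 ≡ x
    ⊠-identityʳ (a , p) = element-≡ (mul-one a p)

    distribˡ : ∀ x y z → x ⊠ (y ⊞ z) ≡ x ⊠ y ⊞ x ⊠ z
    distribˡ (a , p) (b , q) (c , r) = element-≡ (distrib a b c p q r)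

    isCommutativeRing : IsCommutativeRing _≡_ _⊞_ _⊠_ ⊟ 𝟘 𝟙
    isCommutativeRing = record
      { isRing = record
        { +-isAbelianGroup = record
          { isGroup = record
            { isMonoid = record
              { isSemigroup = record
                { isMagma = record { isEquivalence = isEquivalence ; ∙-cong = cong₂ _⊞_ }
                ; assoc   = λ { (a , p) (b , q) (c , r) → element-≡ (add-assoc a b c p q r) } }
              ; identity = (λ x → trans (⊞-comm 𝟘 x) (⊞-identityʳ x)) , ⊞-identityʳ }
            ; inverse = (λ x → trans (⊞-comm (⊟ x) x) (⊟-inverseʳ x)) , ⊟-inverseʳ
            ; ⁻¹-cong = cong ⊟ }
          ; comm = ⊞-comm }
        ; *-cong     = cong₂ _⊠_
        ; *-assoc    = λ { (a , p) (b , q) (c , r) → element-≡ (mul-assoc a b c p q r) }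
        ; *-identity = (λ x → trans (⊠-comm 𝟙 x) (⊠-identityʳ x)) , ⊠-identityʳ
        ; distrib    = distribˡ , λ x y z → trans (⊠-comm (y ⊞ z) x)
                                              (trans (distribˡ x y z) (cong₂ _⊞_ (⊠-comm x y) (⊠-comm x z))) }
      ; *-comm = ⊠-comm }

    _≟ᴱ_ : DecidableEquality Element
    x ≟ᴱ y = map′ element-≡ (cong proj₁) (proj₁ x ℕ.≟ proj₁ y)

    zero-productᴱ : ∀ x y → x ⊠ y ≡ 𝟘 → x ≡ 𝟘 ⊎ y ≡ 𝟘
    zero-productᴱ (a , p) (b , q) e with no-zero-divisors a b p q (cong proj₁ e)
    ... | inj₁ a≡0 = inj₁ (element-≡ a≡0)
    ... | inj₂ b≡0 = inj₂ (element-≡ b≡0)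

  domain : IntegralDomain
  domain = record
    { Carrier = Element ; _+_ = _⊞_ ; _*_ = _⊠_ ; -_ = ⊟ ; 0# = 𝟘 ; 1# = 𝟙
    ; isCommutativeRing = isCommutativeRing ; _≟_ = _≟ᴱ_ ; zero-product = zero-productᴱ }

  open Polynomials domain using (Poly; _⊕_; _∙_; _⊗_; _∷ₙ_; trim)

  ↓ : Poly → List ℕ
  ↓ = map proj₁

  ↓-injective : ∀ p q → ↓ p ≡ ↓ q → p ≡ q
  ↓-injective p q = map-injective element-≡

  ↓-⊕ : ∀ p q → ↓ (p ⊕ q) ≡ polyAdd R (↓ p) (↓ q)
  ↓-⊕ []      q       = refl
  ↓-⊕ (a ∷ p) []      = refl
  ↓-⊕ (a ∷ p) (b ∷ q) = cong (add (proj₁ a) (proj₁ b) ∷_) (↓-⊕ p q)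

  ↓-⊗ : ∀ p q → ↓ (p ⊗ q) ≡ polyMul R (↓ p) (↓ q)
  ↓-⊗ []      q = refl
  ↓-⊗ (a ∷ p) q = trans (↓-⊕ (a ∙ q) (𝟘 ∷ p ⊗ q)) (cong₂ (polyAdd R) (↓-∙ q) (cong (zeroA ∷_) (↓-⊗ p q)))
    where
    ↓-∙ : ∀ q → ↓ (a ∙ q) ≡ map (mul (proj₁ a)) (↓ q)
    ↓-∙ []      = refl
    ↓-∙ (b ∷ q) = cong (mul (proj₁ a) (proj₁ b) ∷_) (↓-∙ q)

  consNormal : ℕ → List ℕ → List ℕ
  consNormal c [] with c ℕ.≟ zeroA
  ... | yes _ = []
  ... | no  _ = c ∷ []
  consNormal c (d ∷ ds) = c ∷ d ∷ ds

  normalize-∷ : ∀ c p → normalize R (c ∷ p) ≡ consNormal c (normalize R p)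
  normalize-∷ c p = trans (cong (reverse ∘ dropZeros R) (unfold-reverse c p)) (dropZeros-∷ʳ (reverse p))
    where
    consNormal-∷ʳ : ∀ ys y → consNormal c (ys ∷ʳ y) ≡ c ∷ ys ∷ʳ y
    consNormal-∷ʳ []      y = refl
    consNormal-∷ʳ (_ ∷ _) y = refl
    dropZeros-∷ʳ : ∀ xs → reverse (dropZeros R (xs ∷ʳ c)) ≡ consNormal c (reverse (dropZeros R xs))
    dropZeros-∷ʳ [] with c ℕ.≟ zeroA
    ... | yes _ = refl
    ... | no  _ = refl
    dropZeros-∷ʳ (x ∷ xs) with x ℕ.≟ zeroA
    ... | yes _ = dropZeros-∷ʳ xs
    ... | no  _ = begin
      reverse (x ∷ xs ++ c ∷ [])       ≡⟨ reverse-++ (x ∷ xs) (c ∷ []) ⟩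
      c ∷ reverse (x ∷ xs)            ≡⟨ cong (c ∷_) (unfold-reverse x xs) ⟩
      c ∷ reverse xs ∷ʳ x             ≡⟨ sym (consNormal-∷ʳ (reverse xs) x) ⟩
      consNormal c (reverse xs ∷ʳ x)   ≡⟨ cong (consNormal c) (sym (unfold-reverse x xs)) ⟩
      consNormal c (reverse (x ∷ xs))  ∎
      where open ≡-Reasoning

  ↓-trim : ∀ p → ↓ (trim p) ≡ normalize R (↓ p)
  ↓-trim []      = refl
  ↓-trim (c ∷ p) = trans (↓-∷ₙ (trim p)) (trans (cong (consNormal (proj₁ c)) (↓-trim p)) (sym (normalize-∷ (proj₁ c) (↓ p))))
    where
    ↓-∷ₙ : ∀ q → ↓ (c ∷ₙ q) ≡ consNormal (proj₁ c) (↓ q)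
    ↓-∷ₙ []      with proj₁ c ℕ.≟ zeroA
    ... | yes _ = refl
    ... | no  _ = refl
    ↓-∷ₙ (_ ∷ _) = refl

  -- A number as an element of A (0 if it is not in A).
  toElement : ℕ → Element
  toElement k with T? (isA k)
  ... | yes p = k , p
  ... | no  _ = 𝟘

  toElement-in : ∀ {k} (p : InA k) → toElement k ≡ (k , p)
  toElement-in {k} p with T? (isA k)
  ... | yes _   = element-≡ refl
  ... | no  k∉A = contradiction p k∉A

  lift : List ℕ → Poly
  lift = map toElement

  ↓-lift : ∀ {l} → All InA l → ↓ (lift l) ≡ l
  ↓-lift []        = refl
  ↓-lift (p ∷ all) = cong₂ _∷_ (cong proj₁ (toElement-in p)) (↓-lift all)

  lift-trimmed : ∀ g → IsPoly R g → trim (lift g) ≡ lift g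
  lift-trimmed g (in-A , normal) = ↓-injective _ _ (begin
    ↓ (trim (lift g))        ≡⟨ ↓-trim (lift g) ⟩
    normalize R (↓ (lift g)) ≡⟨ cong (normalize R) (↓-lift in-A) ⟩
    normalize R g            ≡⟨ normal ⟩
    g                        ≡⟨ sym (↓-lift in-A) ⟩
    ↓ (lift g)               ∎)
    where open ≡-Reasoning

  module Sequence (infinite : Infinite R) where

    beyond : ℕ → Element
    beyond n = proj₁ (infinite n) , proj₂ (proj₂ (infinite n))

    sequence : ℕ → Element
    sequence zero    = beyond 0
    sequence (suc k) = beyond (suc (proj₁ (sequence k)))

    increasing : ∀ {i j} → i < j → proj₁ (sequence i) < proj₁ (sequence j)
    increasing {i} {suc j} (s≤s i≤j) with m≤n⇒m<n∨m≡n i≤j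
    ... | inj₁ i<j  = <-trans (increasing i<j) (proj₁ (proj₂ (infinite (suc (proj₁ (sequence j))))))
    ... | inj₂ refl = proj₁ (proj₂ (infinite (suc (proj₁ (sequence i)))))

    sequence-injective : ∀ {i j} → sequence i ≡ sequence j → i ≡ j
    sequence-injective {i} {j} e with <-cmp i j
    ... | tri< i<j _ _ = contradiction (cong proj₁ e) (<⇒≢ (increasing i<j))
    ... | tri≈ _ i≡j _ = i≡j
    ... | tri> _ _ j<i = contradiction (sym (cong proj₁ e)) (<⇒≢ (increasing j<i))

module Construction (R : CompIntDomain) (infinite : Infinite R) (D : ℕ → ℕ) where

  open CompIntDomain R
  open Coefficients R
  open Sequence infinite
  open IntegralDomain domain using (0#; _*_; commutativeRing)
  open Polynomials domain
  open CanonicalIndex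
  open ListCoding
  open CommutativeRing commutativeRing using (zeroˡ; zeroʳ)
  open import Data.Bool.Properties using (T?)
  import Data.Nat as ℕ
  open import Data.List using (List; []; _∷_; map; filter)
  open import Data.List.Properties using (≡-dec)
  open import Data.List.Membership.Propositional using (_∈_; lose)
  open import Data.List.Membership.Propositional.Properties using (∈-map⁺; ∈-map⁻; ∈-filter⁺; ∈-filter⁻)
  open import Data.List.Relation.Unary.All using ([]; _∷_; all?)
  open import Data.List.Relation.Unary.Any using (Any; any?; satisfied)
  open import Data.Product using (Σ; _×_; _,_; proj₁; proj₂)
  open import Function using (_∘_)
  open import Relation.Nullary using (yes; no)
  open import Relation.Nullary.Decidable using (_×-dec_)
  open import Relation.Nullary.Negation using (contradiction)
  open import Relation.Unary using (Decidable)
  open import Relation.Binary.PropositionalEquality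

  listedDivisors : Element → List Element
  listedDivisors a = map toElement (members (D (proj₁ a)))

  open DivisorCandidates domain listedDivisors sequence sequence-injective

  candidatesOf : List ℕ → List (List ℕ)
  candidatesOf f = map ↓ (divisorCandidates (lift f))

  DividesVia : List ℕ → List (List ℕ) → List ℕ → Set
  DividesVia f G g = IsPoly R g × Any (λ h → IsPoly R h × normalize R (polyMul R g h) ≡ f) G

  isPoly? : Decidable (IsPoly R)
  isPoly? g = all? (T? ∘ isA) g ×-dec ≡-dec ℕ._≟_ (normalize R g) g

  dividesVia? : ∀ f G → Decidable (DividesVia f G)
  dividesVia? f G g = isPoly? g ×-dec any? (λ h → isPoly? h ×-dec ≡-dec ℕ._≟_ (normalize R (polyMul R g h)) f) G

  divisorList : List ℕ → List (List ℕ)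
  divisorList f = filter (dividesVia? f (candidatesOf f)) (candidatesOf f)

  D′ : ℕ → ℕ
  D′ m = canonIndex (map code (divisorList (decode m)))

  module Correctness (D-divisors : IsSCFFD R D) where

    listedDivisors-complete : ∀ {n} e m → n ≢ 0# → e * m ≡ n → e ∈ listedDivisors n
    listedDivisors-complete {n} e m n≢0 em≡n =
      subst (_∈ listedDivisors n) (toElement-in (proj₂ e)) (∈-map⁺ toElement (members⁺ _ _ listed))
      where
      listed : proj₁ e ∈canon D (proj₁ n)
      listed = proj₂ (D-divisors (proj₁ n) (proj₂ n) (n≢0 ∘ element-≡) (proj₁ e))
                     (proj₂ e , proj₁ m , proj₂ m , cong proj₁ em≡n)

    lifted-factorisation : ∀ {f g h} → IsPoly R f → f ≢ [] → IsPoly R g → IsPoly R h →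
                           normalize R (polyMul R g h) ≡ f →
                           LeadingNonZero (lift f) × LeadingNonZero (lift g) × LeadingNonZero (lift h) ×
                           lift g ⊗ lift h ≡ lift f
    lifted-factorisation {f} {g} {h} pf f≢[] pg ph gh≡f =
      lf , factorisation (lift g) (lift h) lf (lift-trimmed g pg) (lift-trimmed h ph) trimmed-product
      where
      lf : LeadingNonZero (lift f)
      lf = trimmed-nonempty⇒LeadingNonZero (lift f) (lift-trimmed f pf)
             (λ lf≡[] → f≢[] (trans (sym (↓-lift (proj₁ pf))) (cong ↓ lf≡[])))
      trimmed-product : trim (lift g ⊗ lift h) ≡ lift f
      trimmed-product = ↓-injective _ _ (begin
        ↓ (trim (lift g ⊗ lift h))                    ≡⟨ ↓-trim (lift g ⊗ lift h) ⟩
        normalize R (↓ (lift g ⊗ lift h))              ≡⟨ cong (normalize R) (↓-⊗ (lift g) (lift h)) ⟩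
        normalize R (polyMul R (↓ (lift g)) (↓ (lift h))) ≡⟨ cong₂ (λ p q → normalize R (polyMul R p q))
                                                                 (↓-lift (proj₁ pg)) (↓-lift (proj₁ ph)) ⟩
        normalize R (polyMul R g h)                    ≡⟨ gh≡f ⟩
        f                                              ≡⟨ sym (↓-lift (proj₁ pf)) ⟩
        ↓ (lift f)                                     ∎)
        where open ≡-Reasoning

    factors∈candidatesOf : ∀ {f g h} → IsPoly R f → f ≢ [] → IsPoly R g → IsPoly R h →
                           normalize R (polyMul R g h) ≡ f → g ∈ candidatesOf f × h ∈ candidatesOf f
    factors∈candidatesOf {f} {g} {h} pf f≢[] pg ph gh≡f
      with lifted-factorisation pf f≢[] pg ph gh≡f
    ... | lf , lg , lh , product with factors∈divisorCandidates listedDivisors-complete lf lg lh product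
    ...   | g∈ , h∈ = subst (_∈ candidatesOf f) (↓-lift (proj₁ pg)) (∈-map⁺ ↓ g∈)
                    , subst (_∈ candidatesOf f) (↓-lift (proj₁ ph)) (∈-map⁺ ↓ h∈)

    -- D′ lists exactly the divisors: the filter keeps precisely them, because the
    -- cofactor of a divisor is itself a candidate.
    D′-divisors : IsPolySCFFD R D′
    D′-divisors f pf f≢[] i = to , from
      where
      index≡ : D′ (code f) ≡ canonIndex (map code (divisorList f))
      index≡ = cong (λ l → canonIndex (map code (divisorList l))) (decode-code f)
      to : i ∈canon D′ (code f) → Σ (List ℕ) λ g → code g ≡ i × DividesPoly R g f
      to i∈ with ∈-map⁻ code (canonIndex⁻ (map code (divisorList f)) i (subst (i ∈canon_) index≡ i∈))
      ... | g , g∈ , i≡code with ∈-filter⁻ (dividesVia? f (candidatesOf f)) {xs = candidatesOf f} g∈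
      ...   | _ , pg , cofactor with satisfied cofactor
      ...     | h , ph , gh≡f = g , sym i≡code , pg , h , ph , gh≡f
      from : (Σ (List ℕ) λ g → code g ≡ i × DividesPoly R g f) → i ∈canon D′ (code f)
      from (g , refl , pg , h , ph , gh≡f) =
        subst (code g ∈canon_) (sym index≡) (canonIndex⁺ (map code (divisorList f)) (code g) (∈-map⁺ code listed))
        where
        factors∈ : g ∈ candidatesOf f × h ∈ candidatesOf f
        factors∈ = factors∈candidatesOf pf f≢[] pg ph gh≡f
        listed : g ∈ divisorList f
        listed = ∈-filter⁺ (dividesVia? f (candidatesOf f)) (proj₁ factors∈) (pg , lose (proj₂ factors∈) (ph , gh≡f))

    normalize-constant : ∀ {x} → x ≢ zeroA → normalize R (x ∷ []) ≡ x ∷ []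
    normalize-constant {x} x≢0 with x ℕ.≟ zeroA
    ... | yes x≡0 = contradiction x≡0 x≢0
    ... | no  _   = refl

    -- The divisors of a nonzero constant a in A[x] are the constants d with d ∣ a in A.
    -- (Opaque: only the statement is used, and unfolding the proof inside types
    -- of later goals makes type checking needlessly slow.)
    opaque
      constant-divisor⁻ : ∀ {a g} → InA a → a ≢ zeroA → DividesPoly R g (a ∷ []) →
                          Σ ℕ λ d → g ≡ d ∷ [] × DividesA R d a
      constant-divisor⁻ {a} {g} pa a≢0 (pg , h , ph , gh≡a)
        with lifted-factorisation ((pa ∷ []) , normalize-constant a≢0) (λ ()) pg ph gh≡a
      ... | _ , lg , lh , product with constant-factors lg lh product
      ...   | (d , pd) , (e , pe) , lg≡d , _ , de≡a =
        d , trans (sym (↓-lift (proj₁ pg))) (cong ↓ lg≡d)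
          , pd , e , pe , trans (cong proj₁ de≡a) (cong proj₁ (toElement-in pa))

    constant-divisor⁺ : ∀ {a d} → a ≢ zeroA → DividesA R d a →
                        normalize R (d ∷ []) ≡ d ∷ [] × DividesPoly R (d ∷ []) (a ∷ [])
    constant-divisor⁺ {a} {d} a≢0 (pd , e , pe , de≡a) =
      normalize-constant d≢0 , ((pd ∷ []) , normalize-constant d≢0) , e ∷ [] , ((pe ∷ []) , normalize-constant e≢0) , product
      where
      d≢0 : d ≢ zeroA
      d≢0 d≡0 = a≢0 (trans (sym de≡a) (trans (cong (λ x → mul x e) d≡0) (cong proj₁ (zeroˡ (e , pe)))))
      e≢0 : e ≢ zeroA
      e≢0 e≡0 = a≢0 (trans (sym de≡a) (trans (cong (mul d) e≡0) (cong proj₁ (zeroʳ (d , pd)))))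
      product : normalize R (polyMul R (d ∷ []) (e ∷ [])) ≡ a ∷ []
      product = trans (cong (λ x → normalize R (x ∷ [])) (trans (add-zero (mul d e) (mul-closed d e pd pe)) de≡a))
                      (normalize-constant a≢0)

    D′-extends : Extends R D D′
    D′-extends a pa a≢0 i = to , from
      where
      ι≡ : ι R a ≡ code (a ∷ [])
      ι≡ = cong code (normalize-constant a≢0)
      divisorsOfConstant : (i ∈canon D′ (code (a ∷ []))) ⇔ (Σ (List ℕ) λ g → code g ≡ i × DividesPoly R g (a ∷ []))
      divisorsOfConstant = D′-divisors (a ∷ []) ((pa ∷ []) , normalize-constant a≢0) (λ ()) i
      to : i ∈canon D′ (ι R a) → Σ ℕ λ d → d ∈canon D a × i ≡ ι R d
      to i∈ = constant-index (proj₁ divisorsOfConstant (subst (λ n → i ∈canon D′ n) ι≡ i∈))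
        where
        constant-index : (Σ (List ℕ) λ g → code g ≡ i × DividesPoly R g (a ∷ [])) →
                         Σ ℕ λ d → d ∈canon D a × i ≡ ι R d
        constant-index (g , code≡i , g∣a) with constant-divisor⁻ pa a≢0 g∣a
        ... | d , refl , d∣a = d , proj₂ (D-divisors a pa a≢0 d) d∣a
                                 , trans (sym code≡i) (cong code (sym (proj₂ (proj₁ g∣a))))
      from : (Σ ℕ λ d → d ∈canon D a × i ≡ ι R d) → i ∈canon D′ (ι R a)
      from (d , d∈ , i≡ιd) = subst (λ n → i ∈canon D′ n) (sym ι≡) (proj₂ divisorsOfConstant
        (d ∷ [] , trans (cong code (sym (proj₁ d[a]))) (sym i≡ιd) , proj₂ d[a]))
        where
        d[a] : normalize R (d ∷ []) ≡ d ∷ [] × DividesPoly R (d ∷ []) (a ∷ [])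
        d[a] = constant-divisor⁺ a≢0 (proj₁ (D-divisors a pa a≢0 d) d∈)

mainTheorem7 : (R : CompIntDomain) → Infinite R →
    Σ ((ℕ → ℕ) → (ℕ → ℕ)) λ Φ →
      ∀ D → IsSCFFD R D → IsPolySCFFD R (Φ D) × Extends R D (Φ D)
mainTheorem7 R infinite =
  (λ D → Construction.D′ R infinite D) ,
  λ D D-divisors → let open Construction.Correctness R infinite D D-divisors in
                   D′-divisors , D′-extends
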